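{- Let $\Sigma$ be a (possibly infinite) unranked signature, $\mathcal{X}$ an infinite set of variables disjoint from $\Sigma$, and $<$ a well-founded partial order on $\Sigma$. Then the rewrite relation $\Rightarrow$ induced by the system $\mathit{Star}^\omega$ on the trees $\mathbb{T}(\Sigma\cup\Sigma^\omega,\mathcal{X})$ is terminating: there is no infinite sequence $t_0\Rightarrow t_1\Rightarrow t_2\Rightarrow\cdots$.
   Context: Terms: for an unranked signature $\Gamma$ (a set of symbols without fixed arity) and a set $\mathcal{X}$ of variables disjoint from $\Gamma$, the set of terms $\mathcal{T}(\Gamma,\mathcal{X})$ is the smallest set containing $\mathcal{X}$ and containing $f(t_1,\ldots,t_n)$ for all $f\in\Gamma$, $n\ge 0$ and terms $t_1,\ldots,t_n$. The (unordered) trees $\mathbb{T}(\Gamma,\mathcal{X})$ are the equivalence classes of terms modulo the equivalence generated by swapping adjacent arguments of a symbol anywhere inside a term. Rewrite rules are applied to terms under arbitrary contexts and substitutions, and the relation is extended to trees by $[s]\to[t]$ whenever $s\to t$ for terms $s,t$ with classes $[s],[t]$. Energized signature: for every $f\in\Sigma$ and $n\in\mathbb{N}$ let $f^n$ be a fresh symbol, and $\Sigma^\omega=\{f^n\mid f\in\Sigma,\ n\in\mathbb{N}\}$. The system $\mathit{Star}^\omega$ consists of the following rules, for all $n\in\mathbb{N}$ and $f,g\in\Sigma$, where $\vec s,\vec u$ are arbitrary finite (possibly empty) vectors of arguments and $t$ is an argument: (put) $f(\vec s)\Rightarrow f^n(\vec s)$; (select) $f^{n+1}(\vec s,t,\vec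 u)\Rightarrow t$; (copy) $f^{n+1}(\vec s)\Rightarrow g(f^n(\vec s),\ldots,f^n(\vec s))$ with $0$ or more copies of $f^n(\vec s)$, if $f>g$; (down) $f^{n+1}(\vec s,t,\vec u)\Rightarrow f(\vec s,t^n,\ldots,t^n,\vec u)$ with $0$ or more copies of $t^n$, where $t=g(\vec v)$ has an unmarked root symbol $g\in\Sigma$ and $t^n$ denotes $g^n(\vec v)$. -}

module Defs where

open import Level using (Level; _⊔_)
open import Data.Nat.Base using (ℕ; suc)
open import Data.Fin.Base using (Fin)
open import Data.List.Base using (List; []; _∷_; _++_; replicate)
open import Data.Product.Base using (∃; ∃₂; _×_)
open import Data.Sum.Base using (_⊎_; inj₁; inj₂)
open import Function.Bundles using (_⤖_)
open import Relation.Binary.Bundles using (Setoid)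
open import Relation.Binary.Core using (Rel)
open import Relation.Nullary.Negation.Core using (¬_)
import Relation.Binary.Construct.Closure.Equivalence as EqClosure

private
  variable
    a b ℓ : Level

Infinite : Set a → Set a
Infinite A = ¬ (∃ λ n → Fin n ⤖ A)

Terminating : {A : Set a} → Rel A ℓ → Set (a ⊔ ℓ)
Terminating {A = A} _⟶_ = ¬ (∃ λ (t : ℕ → A) → ∀ i → t i ⟶ t (suc i))

data Term (Γ : Set a) (X : Set b) : Set (a ⊔ b) where
  var  : X → Term Γ X
  node : Γ → List (Term Γ X) → Term Γ X

module _ {Γ : Set a} {X : Set b} where

  Substitution : Set (a ⊔ b)
  Substitution = X → Term Γ X

  mutual
    subst : Substitution → Term Γ X → Term Γ X
    subst σ (var x)     = σ x
    subst σ (node f ts) = node f (substs σ ts)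

    -- map (subst σ), inlined for the termination checker
    substs : Substitution → List (Term Γ X) → List (Term Γ X)
    substs σ []       = []
    substs σ (t ∷ ts) = subst σ t ∷ substs σ ts

  data ContextClosure (R : Rel (Term Γ X) ℓ) : Rel (Term Γ X) (a ⊔ b ⊔ ℓ) where
    root : ∀ {s t} → R s t → ContextClosure R s t
    arg  : ∀ f ss us {s t} → ContextClosure R s t →
           ContextClosure R (node f (ss ++ s ∷ us)) (node f (ss ++ t ∷ us))

  data SubstitutionClosure (R : Rel (Term Γ X) ℓ) : Rel (Term Γ X) (a ⊔ b ⊔ ℓ) where
    inst : ∀ σ {l r} → R l r → SubstitutionClosure R (subst σ l) (subst σ r)

  TermRewrite : Rel (Term Γ X) ℓ → Rel (Term Γ X) (a ⊔ b ⊔ ℓ)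
  TermRewrite R = ContextClosure (SubstitutionClosure R)

  data AdjacentSwap : Rel (Term Γ X) (a ⊔ b) where
    swap : ∀ f ss s t us →
           AdjacentSwap (node f (ss ++ s ∷ t ∷ us)) (node f (ss ++ t ∷ s ∷ us))

-- A tree is represented by any of its terms; equality of trees is the
-- setoid equality.
Trees : Set a → Set b → Setoid (a ⊔ b) (a ⊔ b)
Trees Γ X = EqClosure.setoid (ContextClosure (AdjacentSwap {Γ = Γ} {X = X}))

module _ {Γ : Set a} {X : Set b} where

  open Setoid (Trees Γ X) renaming (Carrier to Tree)

  TreeRewrite : Rel (Term Γ X) ℓ → Rel Tree (a ⊔ b ⊔ ℓ)
  TreeRewrite R s t = ∃₂ λ s′ t′ → s ≈ s′ × TermRewrite R s′ t′ × t′ ≈ t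

infix 8 _^_

data Energized (S : Set a) : Set a where
  _^_ : S → ℕ → Energized S

StarSignature : Set a → Set a
StarSignature S = S ⊎ Energized S

module _ {S : Set a} (_<_ : Rel S ℓ) (X : Set b) where

  private
    T : Set (a ⊔ b)
    T = Term (StarSignature S) X

    plain : S → List T → T
    plain f = node (inj₁ f)

    marked : S → ℕ → List T → T
    marked f n = node (inj₂ (f ^ n))

  data Starω : Rel T (a ⊔ b ⊔ ℓ) where
    put    : ∀ f n ss → Starω (plain f ss) (marked f n ss)
    select : ∀ f n ss t us → Starω (marked f (suc n) (ss ++ t ∷ us)) t
    copy   : ∀ f g n k ss → g < f →
             Starω (marked f (suc n) ss) (plain g (replicate k (marked f n ss)))
    down   : ∀ f g n k ss vs us →
             Starω (marked f (suc n) (ss ++ plain g vs ∷ us))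
                   (plain f (ss ++ replicate k (marked g n vs) ++ us))

{-# OPTIONS --safe #-}
module Submission where

-- Call a tree strongly normalizing (SN) when it is accessible for the
-- converse of the rewrite relation.  Every tree is SN, by induction on
-- terms, once f(ts) and every f^n(ts) are known to be SN whenever all the
-- arguments ts are SN.  This is proved by induction on the triple
-- consisting of
--
--   1. the symbol f, ordered by the well-founded order on the signature,
--   2. the multiset of arguments ts, where one step replaces an argument by
--      finitely many of its reducts,
--   3. the marking of the root, "unmarked" being above every number n,
--
-- compared lexicographically.  It is enough that every one-step reduct is SN:
--
--   * a step inside an argument decreases 2;
--   * (put) and the passage from f^(n+1)(ts) to f^n(ts) decrease 3;
--   * (select) yields an argument, which is SN;
--   * (copy) yields g(f^n(ts),...,f^n(ts)) whose arguments are SN because 3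
--     decreases, and which is then SN because 1 decreases;
--   * (down) replaces an argument t by copies of t^n, and t rewrites to t^n
--     by (put), so that 2 decreases.
--
-- Component 2 is well-founded on lists of SN trees (SN-all⇒SN≫), by the usual
-- nested induction for multisets.  Passing from terms to trees costs nothing
-- beyond reordering arguments: equivalent terms have the same root and
-- permuted arguments (≈⇒≃), and permutations commute with the steps of 2
-- (↭-≫-commute).

open import Defs
open import Level using (Level; _⊔_)
open import Data.Nat.Base using (ℕ; zero; suc)
open import Data.List.Base using (List; []; _∷_; _++_; replicate)
open import Data.List.Relation.Binary.Pointwise.Base using ([]; _∷_)
import Data.List.Relation.Binary.Permutation.Setoid as Permutation
import Data.List.Relation.Binary.Permutation.Setoid.Properties as Permutationₚ
open import Data.List.Relation.Unary.All as All using (All; []; _∷_)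
open import Data.List.Relation.Unary.All.Properties using (replicate⁺)
open import Data.Empty using (⊥; ⊥-elim)
open import Data.Product.Base using (∃; ∃₂; _×_; _,_)
open import Data.Sum.Base using (inj₁; inj₂)
open import Function.Base using (flip)
open import Induction.WellFounded using (WellFounded; Acc; acc)
open import Relation.Binary.Bundles using (Setoid)
open import Relation.Binary.Core using (Rel)
open import Relation.Binary.Structures using (IsEquivalence; IsStrictPartialOrder)
open import Relation.Binary.PropositionalEquality.Core
  using (_≡_; refl; cong)
import Relation.Binary.Construct.Closure.Equivalence as EqClosure

private
  variable
    a b c ℓ r : Level

------------------------------------------------------------------------
-- Infinite sequences

acc⇒¬sequence : {A : Set a} {R : Rel A r} (t : ℕ → A) →
                (∀ i → R (t i) (t (suc i))) → ∀ i → Acc (flip R) (t i) → ⊥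
acc⇒¬sequence t steps i (acc rs) =
  acc⇒¬sequence t steps (suc i) (rs (steps i))

------------------------------------------------------------------------
-- Multiset descent

module MultisetDescent
  (S : Setoid c ℓ) (_⇒_ : Rel (Setoid.Carrier S) r)
  (⇒-respˡ-≈ : ∀ {x y z} → Setoid._≈_ S x y → y ⇒ z → x ⇒ z) where

  open Setoid S using (_≈_) renaming (Carrier to A; sym to ≈-sym)
  open Permutation S
  open Permutationₚ S

  -- One step of the multiset extension, on lists: one element is replaced,
  -- in place, by finitely many of its reducts.
  data _≫_ : Rel (List A) (c ⊔ r) where
    here  : ∀ {x ys} zs → All (x ⇒_) ys → (x ∷ zs) ≫ (ys ++ zs)
    there : ∀ x {ys zs} → ys ≫ zs → (x ∷ ys) ≫ (x ∷ zs)

  replace : ∀ xs {x ys} zs → All (x ⇒_) ys → (xs ++ x ∷ zs) ≫ (xs ++ ys ++ zs)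
  replace []       zs x⇒ys = here zs x⇒ys
  replace (w ∷ xs) zs x⇒ys = there w (replace xs zs x⇒ys)

  -- This is what makes a relation on lists serve as one on multisets.
  ↭-≫-commute : ∀ {xs ys zs} → xs ↭ ys → ys ≫ zs → ∃ λ ws → xs ≫ ws × ws ↭ zs
  ↭-≫-commute (refl (x≈y ∷ xs≋ys)) (here {ys = vs} _ y⇒vs) =
    _ , here _ (All.map (⇒-respˡ-≈ x≈y) y⇒vs) , ++⁺ˡ vs (refl xs≋ys)
  ↭-≫-commute (refl (x≈y ∷ xs≋ys)) (there _ ys≫zs)
    with _ , xs≫ws , ws↭zs ← ↭-≫-commute (refl xs≋ys) ys≫zs =
    _ , there _ xs≫ws , prep x≈y ws↭zs
  ↭-≫-commute (prep x≈y xs↭ys) (here {ys = vs} _ y⇒vs) =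
    _ , here _ (All.map (⇒-respˡ-≈ x≈y) y⇒vs) , ++⁺ˡ vs xs↭ys
  ↭-≫-commute (prep x≈y xs↭ys) (there _ ys≫zs)
    with _ , xs≫ws , ws↭zs ← ↭-≫-commute xs↭ys ys≫zs =
    _ , there _ xs≫ws , prep x≈y ws↭zs
  ↭-≫-commute (swap x≈x′ y≈y′ xs↭ys) (here {ys = vs} _ y′⇒vs) =
    _ , there _ (here _ (All.map (⇒-respˡ-≈ y≈y′) y′⇒vs)) ,
    ↭-trans (↭-sym (shift (≈-sym x≈x′) vs _)) (++⁺ˡ vs (↭-prep _ xs↭ys))
  ↭-≫-commute (swap x≈x′ y≈y′ xs↭ys) (there _ (here {ys = vs} _ x′⇒vs)) =
    _ , here _ (All.map (⇒-respˡ-≈ x≈x′) x′⇒vs) ,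
    ↭-trans (shift y≈y′ vs _) (↭-prep _ (++⁺ˡ vs xs↭ys))
  ↭-≫-commute (swap x≈x′ y≈y′ xs↭ys) (there _ (there _ ys≫zs))
    with _ , xs≫ws , ws↭zs ← ↭-≫-commute xs↭ys ys≫zs =
    _ , there _ (there _ xs≫ws) , swap x≈x′ y≈y′ ws↭zs
  ↭-≫-commute (trans xs↭ys ys↭zs) zs≫vs
    with _ , ys≫us , us↭vs ← ↭-≫-commute ys↭zs zs≫vs
    with _ , xs≫ws , ws↭us ← ↭-≫-commute xs↭ys ys≫us =
    _ , xs≫ws , ↭-trans ws↭us us↭vs

  -- Strong normalization of elements for _⇒_, and of lists for _≫_.
  SN : A → Set _
  SN = Acc (flip _⇒_)

  SN≫ : List A → Set _
  SN≫ = Acc (flip _≫_)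

  SN-resp-≈ : ∀ {x y} → x ≈ y → SN x → SN y
  SN-resp-≈ x≈y (acc rs) = acc λ y⇒z → rs (⇒-respˡ-≈ x≈y y⇒z)

  -- Induction on SN x and, inside it, on SN≫ xs.
  mutual
    SN≫-∷ : ∀ {x xs} → SN x → SN≫ xs → SN≫ (x ∷ xs)
    SN≫-∷ sn sns = acc (SN≫-∷-reduct sn sns)

    SN≫-∷-reduct : ∀ {x xs zs} → SN x → SN≫ xs → (x ∷ xs) ≫ zs → SN≫ zs
    SN≫-∷-reduct {x} {xs} (acc rs) sns (here _ x⇒ys) = prepend x⇒ys
      where
      prepend : ∀ {ys} → All (x ⇒_) ys → SN≫ (ys ++ xs)
      prepend []           = sns
      prepend (x⇒y ∷ x⇒ys) = SN≫-∷ (rs x⇒y) (prepend x⇒ys)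
    SN≫-∷-reduct sn (acc rss) (there _ xs≫ys) = SN≫-∷ sn (rss xs≫ys)

  SN-all⇒SN≫ : ∀ {xs} → All SN xs → SN≫ xs
  SN-all⇒SN≫ []         = acc λ ()
  SN-all⇒SN≫ (sn ∷ sns) = SN≫-∷ sn (SN-all⇒SN≫ sns)

  -- Each element of a strongly normalizing multiset is strongly normalizing,
  -- because a step of an element is a step of the list.
  SN≫⇒SN : ∀ {xs} → SN≫ xs → ∀ ys {y zs} → xs ↭ ys ++ y ∷ zs → SN y
  SN≫⇒SN (acc rss) ys {zs = zs} xs↭ = acc λ y⇒z →
    let _ , xs≫ws , ws↭ = ↭-≫-commute xs↭ (replace ys zs (y⇒z ∷ []))
    in SN≫⇒SN (rss xs≫ws) ys ws↭

------------------------------------------------------------------------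
-- Equality of trees

module _ {Γ : Set a} {X : Set b} where

  private
    T = Term Γ X

  open Setoid (Trees Γ X) using (_≈_)
  open Permutation (Trees Γ X)
  open Permutationₚ (Trees Γ X) using (++⁺ˡ)

  -- Same root, and the same arguments up to reordering and equality of trees.
  data _≃_ : Rel T (a ⊔ b) where
    var  : ∀ x → var x ≃ var x
    node : ∀ f {ts us} → ts ↭ us → node f ts ≃ node f us

  ≃-isEquivalence : IsEquivalence _≃_
  ≃-isEquivalence = record { refl = ≃-refl ; sym = ≃-sym ; trans = ≃-trans }
    where
    ≃-refl : ∀ {t} → t ≃ t
    ≃-refl {var x}     = var x
    ≃-refl {node f ts} = node f ↭-refl

    ≃-sym : ∀ {s t} → s ≃ t → t ≃ s
    ≃-sym (var x)    = var x
    ≃-sym (node f p) = node f (↭-sym p)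

    ≃-trans : ∀ {s t u} → s ≃ t → t ≃ u → s ≃ u
    ≃-trans (var x)    (var .x)    = var x
    ≃-trans (node f p) (node .f q) = node f (↭-trans p q)

  ≈⇒≃ : ∀ {s t} → s ≈ t → s ≃ t
  ≈⇒≃ = EqClosure.fold ≃-isEquivalence λ where
    (root (swap f ss s t us)) → node f (++⁺ˡ ss (↭-swap s t ↭-refl))
    (arg f ss us s~t)         →
      node f (++⁺ˡ ss (prep (EqClosure.return s~t) ↭-refl))

------------------------------------------------------------------------
-- Substitution instances of the rules

module _ {Γ : Set a} {X : Set b} (σ : Substitution {Γ = Γ} {X = X}) where

  substs-++ : ∀ ss us → substs σ (ss ++ us) ≡ substs σ ss ++ substs σ us
  substs-++ []       us = refl
  substs-++ (s ∷ ss) us = cong (subst σ s ∷_) (substs-++ ss us)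

  substs-replicate : ∀ k t → substs σ (replicate k t) ≡ replicate k (subst σ t)
  substs-replicate zero    t = refl
  substs-replicate (suc k) t = cong (subst σ t ∷_) (substs-replicate k t)

module _ {S : Set a} (_<_ : Rel S ℓ) (X : Set b) where

  private
    T : Set (a ⊔ b)
    T = Term (StarSignature S) X

    plain : S → List T → T
    plain f = node (inj₁ f)

    marked : S → ℕ → List T → T
    marked f n = node (inj₂ (f ^ n))

    Rule : Rel T _
    Rule = Starω _<_ X

  -- The rules are schemes over all terms, hence closed under substitution, so
  -- that substitutions can be left out of the rewrite relation.
  Rule-subst : ∀ σ {l r} → Rule l r → Rule (subst σ l) (subst σ r)
  Rule-subst σ (put f n ss) = put f n (substs σ ss)
  Rule-subst σ (select f n ss t us)
    rewrite substs-++ σ ss (t ∷ us) =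
    select f n (substs σ ss) (subst σ t) (substs σ us)
  Rule-subst σ (copy f g n k ss g<f)
    rewrite substs-replicate σ k (marked f n ss) =
    copy f g n k (substs σ ss) g<f
  Rule-subst σ (down f g n k ss vs us)
    rewrite substs-++ σ ss (plain g vs ∷ us)
          | substs-++ σ ss (replicate k (marked g n vs) ++ us)
          | substs-++ σ (replicate k (marked g n vs)) us
          | substs-replicate σ k (marked g n vs) =
    down f g n k (substs σ ss) (substs σ vs) (substs σ us)

  -- Rewriting of terms, with the rule schemes applied directly.
  _⟶_ : Rel T _
  _⟶_ = ContextClosure Rule

  TermRewrite⊆⟶ : ∀ {s t} → TermRewrite Rule s t → s ⟶ t
  TermRewrite⊆⟶ (root (inst σ l⇒r)) = root (Rule-subst σ l⇒r)
  TermRewrite⊆⟶ (arg f ss us s⇒t)   = arg f ss us (TermRewrite⊆⟶ s⇒t)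

------------------------------------------------------------------------
-- Strong normalization

  open Setoid (Trees (StarSignature S) X) using (_≈_)
    renaming (refl to ≈-refl; trans to ≈-trans)
  open Permutation (Trees (StarSignature S) X)

  -- The relation that _⟶_ induces on trees.
  _⇒_ : Rel T _
  s ⇒ t = ∃₂ λ s′ t′ → s ≈ s′ × s′ ⟶ t′ × t′ ≈ t

  ⟶⊆⇒ : ∀ {s t} → s ⟶ t → s ⇒ t
  ⟶⊆⇒ s⟶t = _ , _ , ≈-refl , s⟶t , ≈-refl

  TreeRewrite⊆⇒ : ∀ {s t} → TreeRewrite Rule s t → s ⇒ t
  TreeRewrite⊆⇒ (s′ , t′ , s≈s′ , s′⇒t′ , t′≈t) =
    s′ , t′ , s≈s′ , TermRewrite⊆⟶ s′⇒t′ , t′≈t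

  ⇒-respˡ-≈ : ∀ {s t u} → s ≈ t → t ⇒ u → s ⇒ u
  ⇒-respˡ-≈ s≈t (t′ , u′ , t≈t′ , rest) = t′ , u′ , ≈-trans s≈t t≈t′ , rest

  open MultisetDescent (Trees (StarSignature S) X) _⇒_ ⇒-respˡ-≈

  SN-var : ∀ x → SN (var x)
  SN-var x = acc λ (_ , _ , x≈s , s⟶t , _) →
    ⊥-elim (irreducible (≈⇒≃ x≈s) s⟶t)
    where
    irreducible : ∀ {s t} → var x ≃ s → s ⟶ t → ⊥
    irreducible (var _) (root ())

  SN-node : ∀ {f ts} →
            (∀ {us v} → ts ↭ us → node f us ⟶ v → SN v) → SN (node f ts)
  SN-node {f} {ts} reducts = acc λ (_ , _ , t≈s , s⟶v , v≈u) →
    SN-resp-≈ v≈u (go (≈⇒≃ t≈s) s⟶v)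
    where
    go : ∀ {s v} → node f ts ≃ s → s ⟶ v → SN v
    go (node _ ts↭us) = reducts ts↭us

  -- The lexicographic induction.  The induction is on a list ts of which the
  -- actual arguments us are a permutation, so that reordering the arguments
  -- leaves the measure unchanged.
  mutual
    SN-plain : ∀ {f ts us} → Acc _<_ f → SN≫ ts → ts ↭ us → SN (plain f us)
    SN-plain af at ts↭us = SN-node λ us↭vs →
      SN-plain-reduct af at (↭-trans ts↭us us↭vs)

    SN-marked : ∀ {f ts us} n →
                Acc _<_ f → SN≫ ts → ts ↭ us → SN (marked f n us)
    SN-marked n af at ts↭us = SN-node λ us↭vs →
      SN-marked-reduct n af at (↭-trans ts↭us us↭vs)

    SN-plain-reduct : ∀ {f ts us v} → Acc _<_ f → SN≫ ts → ts ↭ us →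
                      plain f us ⟶ v → SN v
    SN-plain-reduct af at ts↭us (root (put f n us)) = SN-marked n af at ts↭us
    SN-plain-reduct af (acc rs) ts↭us (arg _ ss us s⟶t)
      with _ , ts≫ws , ws↭ ← ↭-≫-commute ts↭us
                               (replace ss us (⟶⊆⇒ s⟶t ∷ [])) =
      SN-plain af (rs ts≫ws) ws↭

    SN-marked-reduct : ∀ {f ts us v} n → Acc _<_ f → SN≫ ts → ts ↭ us →
                       marked f n us ⟶ v → SN v
    SN-marked-reduct (suc n) af at ts↭us (root (select f n ss t us)) =
      SN≫⇒SN at ss ts↭us
    SN-marked-reduct (suc n) af@(acc rf) at ts↭us
                     (root (copy f g n k us g<f)) =
      SN-plain (rf g<f)
        (SN-all⇒SN≫ (replicate⁺ k (SN-marked n af at ts↭us))) ↭-refl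
    SN-marked-reduct (suc n) af (acc rs) ts↭us
                     (root (down f g n k ss vs us))
      with _ , ts≫ws , ws↭ ← ↭-≫-commute ts↭us
                               (replace ss us
                                 (replicate⁺ k (⟶⊆⇒ (root (put g n vs))))) =
      SN-plain af (rs ts≫ws) ws↭
    SN-marked-reduct n af (acc rs) ts↭us (arg _ ss us s⟶t)
      with _ , ts≫ws , ws↭ ← ↭-≫-commute ts↭us
                               (replace ss us (⟶⊆⇒ s⟶t ∷ [])) =
      SN-marked n af (rs ts≫ws) ws↭

  module _ (<-wf : WellFounded _<_) where

    mutual
      SN-term : ∀ t → SN t
      SN-term (var x) = SN-var x
      SN-term (node (inj₁ f) ts) =
        SN-plain (<-wf f) (SN-all⇒SN≫ (SN-terms ts)) ↭-refl
      SN-term (node (inj₂ (f ^ n)) ts) =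
        SN-marked n (<-wf f) (SN-all⇒SN≫ (SN-terms ts)) ↭-refl

      SN-terms : ∀ ts → All SN ts
      SN-terms []       = []
      SN-terms (t ∷ ts) = SN-term t ∷ SN-terms ts

proposition5p6 : ∀ {a b ℓ : Level} (Σ : Set a) (X : Set b) → Infinite X →
    (_<_ : Rel Σ ℓ) → IsStrictPartialOrder _≡_ _<_ → WellFounded _<_ →
    Terminating (TreeRewrite (Starω _<_ X))
proposition5p6 Σ X _ _<_ _ <-wf (t , steps) =
  acc⇒¬sequence t (λ i → TreeRewrite⊆⇒ _<_ X (steps i)) 0
    (SN-term _<_ X <-wf (t 0))
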